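{- Let $K_n$ be the complete graph on $n$ vertices and let $S\subseteq V(K_n)$ with $|S|=s\geq 2$. Then $K_n$ contains $n-\lceil s/2\rceil$ pairwise completely independent $S$-Steiner trees.
   Context: For $S\subseteq V(G)$ with $|S|\ge 2$, an $S$-Steiner tree of $G$ is a subtree $T$ of $G$ with $S\subseteq V(T)$ all of whose leaves belong to $S$. A family of $S$-Steiner trees $T_1,\dots,T_k$ is completely independent if for all $1\le p<q\le k$: $E(T_p)\cap E(T_q)=\emptyset$, $V(T_p)\cap V(T_q)=S$, and for any two vertices $x_1,x_2\in S$ the $(x_1,x_2)$-paths in $T_p$ and in $T_q$ are internally disjoint. -}

module Defs where

open import Data.Nat using (ℕ; _≤_)
open import Data.Fin as Fin using (Fin)
open import Data.Fin.Subset using (Subset; Nonempty; ∣_∣; _∩_; _∈_; _⊆_)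
open import Data.List using (List; []; _∷_; length)
import Data.List.Membership.Propositional as List
open import Data.List.Relation.Unary.Unique.Propositional using (Unique)
open import Data.Product using (_×_)
open import Data.Vec using (tabulate)
open import Level using (0ℓ)
open import Relation.Binary
  using (Rel; Symmetric; Irreflexive; Decidable)
open import Relation.Binary.Construct.Closure.ReflexiveTransitive
  using (Star; ε; _◅_)
open import Relation.Binary.PropositionalEquality
  using (_≡_; _≢_; ≢-sym)
open import Relation.Nullary using (¬_; does)

record Graph (n : ℕ) : Set₁ where
  field
    Adj    : Rel (Fin n) 0ℓ
    sym    : Symmetric Adj
    irrefl : Irreflexive _≡_ Adj

K : (n : ℕ) → Graph n
K n = record
  { Adj    = _≢_
  ; sym    = ≢-sym
  ; irrefl = λ u≡v u≢v → u≢v u≡v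
  }

-- Edge sets are decidable so that degrees can be counted.
record Subgraph {n : ℕ} (G : Graph n) : Set₁ where
  field
    V     : Subset n
    E     : Rel (Fin n) 0ℓ
    E?    : Decidable E
    E-sym : Symmetric E
    E⊆G   : ∀ {u v} → E u v → Graph.Adj G u v
    E⊆V   : ∀ {u v} → E u v → u ∈ V × v ∈ V

module _ {n : ℕ} {G : Graph n} where

  degree : Subgraph G → Fin n → ℕ
  degree H v = ∣ tabulate (λ w → does (Subgraph.E? H v w)) ∣

  Leaf : Subgraph G → Fin n → Set
  Leaf H v = v ∈ Subgraph.V H × degree H v ≡ 1

  Walk : Subgraph G → Rel (Fin n) 0ℓ
  Walk H = Star (Subgraph.E H)

  vertices : ∀ {H : Subgraph G} {u v} → Walk H u v → List (Fin n)
  vertices {u = u} ε       = u ∷ []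
  vertices {H} {u} (_ ◅ w) = u ∷ vertices {H} w

  -- The trivial walk ε at u is a path even when u is not a vertex of H; every
  -- walk with at least one edge has all its vertices in V.
  record Path (H : Subgraph G) (u v : Fin n) : Set where
    field
      walk   : Walk H u v
      simple : Unique (vertices {H} walk)

  pathVertices : ∀ {H : Subgraph G} {u v} → Path H u v → List (Fin n)
  pathVertices {H} p = vertices {H} (Path.walk p)

  Connected : Subgraph G → Set
  Connected H = ∀ u v → u ∈ Subgraph.V H → v ∈ Subgraph.V H → Path H u v

  -- A cycle is a path on at least three vertices together with an edge joining
  -- its ends.
  Acyclic : Subgraph G → Set
  Acyclic H = ∀ {u v} (p : Path H u v) →
              3 ≤ length (pathVertices p) → ¬ Subgraph.E H v u

  record IsTree (H : Subgraph G) : Set where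
    field
      nonempty  : Nonempty (Subgraph.V H)
      connected : Connected H
      acyclic   : Acyclic H

  Internal : ∀ {H : Subgraph G} {u v} → Path H u v → Fin n → Set
  Internal {u = u} {v} p x = x List.∈ pathVertices p × x ≢ u × x ≢ v

  InternallyDisjoint : ∀ {H H′ : Subgraph G} {u v} →
                       Path H u v → Path H′ u v → Set
  InternallyDisjoint p q = ∀ x → Internal p x → ¬ Internal q x

record SteinerTree {n : ℕ} (G : Graph n) (S : Subset n) : Set₁ where
  field
    subgraph : Subgraph G
    isTree   : IsTree subgraph
    S⊆V      : S ⊆ Subgraph.V subgraph
    leaves∈S : ∀ v → Leaf subgraph v → v ∈ S
  open Subgraph subgraph public

-- Since a tree has exactly one path between any two of its vertices,
-- quantifying over all (x₁,x₂)-paths of the two trees speaks of that pair.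
record CompletelyIndependent {n k : ℕ} {G : Graph n} {S : Subset n}
                             (T : Fin k → SteinerTree G S) : Set where
  open SteinerTree
  field
    edge-disjoint   : ∀ p q → p Fin.< q →
                      ∀ u v → E (T p) u v → ¬ E (T q) u v
    vertices-meet   : ∀ p q → p Fin.< q → V (T p) ∩ V (T q) ≡ S
    paths-disjoint  : ∀ p q → p Fin.< q →
                      ∀ x₁ x₂ → x₁ ∈ S → x₂ ∈ S → x₁ ≢ x₂ →
                      (P : Path (subgraph (T p)) x₁ x₂)
                      (Q : Path (subgraph (T q)) x₁ x₂) →
                      InternallyDisjoint P Q

{-# OPTIONS --safe #-}

-- Write s = ∣S∣.  Each vertex c outside S is the centre of a star with leaf set
-- S.  Pair up the vertices of S, leaving one over if s is odd, and for every
-- pair {a, b} take the double star spanning S with central edge ab: for i < j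
-- the tree of pair i joins aⱼ to aᵢ and bⱼ to bᵢ, whereas the tree of pair j
-- joins aᵢ to bⱼ and bᵢ to aⱼ; the vertex left over is joined to every aᵢ.
-- This gives (n ∸ s) + ⌊s/2⌋ = n ∸ ⌈s/2⌉ trees.  Inner vertices of paths are
-- centres, and the trees have pairwise disjoint sets of centres.

module Submission where

open import Data.Nat
  using (ℕ; zero; suc; _+_; _≥_; _≤_; _<_; _∸_; ⌈_/2⌉; ⌊_/2⌋; parity; s≤s; z≤n)
import Data.Nat.Properties as ℕ
open import Data.Fin as Fin using (Fin; zero; suc; toℕ; fromℕ<)
import Data.Fin.Properties as Fin
open import Data.Fin.Subset
  using (Subset; inside; outside; ∣_∣; _∈_; _∉_; _⊆_; _∪_; _∩_; ⁅_⁆; ∁)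
import Data.Fin.Subset.Properties as Subset
open import Data.List.Relation.Unary.All as All using ([]; _∷_)
open import Data.List.Relation.Unary.All.Properties using (¬Any⇒All¬)
open import Data.List.Relation.Unary.AllPairs using ([]; _∷_)
open import Data.List.Relation.Unary.Any using (here; there)
open import Data.List.Relation.Unary.Unique.Propositional using (Unique)
import Data.List.Membership.Propositional as List
open import Data.Parity using (Parity; 0ℙ; 1ℙ; _⁻¹)
open import Data.Parity.Properties using (p≢p⁻¹)
open import Data.Product using (Σ-syntax; _×_; _,_; proj₁; proj₂; ∃-syntax)
open import Data.Sum using (_⊎_; inj₁; inj₂; swap)
open import Data.Vec using (_∷_; here; there; tabulate)
open import Data.Vec.Properties using (lookup⇒[]=; lookup∘tabulate)
open import Function using (_∘_; const)
open import Relation.Binary using (tri<; tri≈; tri>)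
open import Relation.Binary.Construct.Closure.ReflexiveTransitive
  using (ε; _◅_; _◅◅_; reverse)
open import Relation.Binary.PropositionalEquality
open import Relation.Nullary using (Dec; yes; no; does; contradiction)
open import Relation.Nullary.Decidable
  using (¬?; _×-dec_; _⊎-dec_; dec-true)
open import Defs

private
  variable
    n k : ℕ

-- Walks and paths in a subgraph

module _ {G : Graph n} (H : Subgraph G) where
  open Subgraph H
  open import Data.List.Membership.DecPropositional (Fin._≟_ {n})
    using (_∈?_)

  source∈vertices : ∀ {u v} (w : Walk H u v) → u List.∈ vertices {H = H} w
  source∈vertices ε       = here refl
  source∈vertices (_ ◅ _) = here refl

  target∈vertices : ∀ {u v} (w : Walk H u v) → v List.∈ vertices {H = H} w
  target∈vertices ε       = here refl
  target∈vertices (_ ◅ w) = there (target∈vertices w)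

  suffix : ∀ {u v x} (w : Walk H u v) → Unique (vertices {H = H} w) →
           x List.∈ vertices {H = H} w → Path H x v
  suffix ε       uniq       (here refl) = record { walk = ε ; simple = uniq }
  suffix (e ◅ w) uniq       (here refl) = record { walk = e ◅ w ; simple = uniq }
  suffix (e ◅ w) (_ ∷ uniq) (there x∈w) = suffix w uniq x∈w

  -- If `u` recurs on the loop-free remainder, everything before that occurrence is cut off;
  -- otherwise the first edge is kept.
  eraseLoops : ∀ {u v} → Walk H u v → Path H u v
  eraseLoops ε = record { walk = ε ; simple = [] ∷ [] }
  eraseLoops {u} (e ◅ w) with eraseLoops w
  ... | record { walk = w′ ; simple = uniq } with u ∈? vertices {H = H} w′
  ...   | yes u∈w′ = suffix w′ uniq u∈w′
  ...   | no  u∉w′ = record { walk = e ◅ w′ ; simple = ¬Any⇒All¬ _ u∉w′ ∷ uniq }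

  -- The predecessor and the successor of `x` on the walk serve as `y` and `z`; they differ because
  -- no vertex repeats.
  internal-neighbours : ∀ {u v x} (w : Walk H u v) → Unique (vertices {H = H} w) →
    x List.∈ vertices {H = H} w → x ≢ u → x ≢ v →
    ∃[ y ] ∃[ z ] y ≢ z × E y x × E x z
  internal-neighbours ε _ (here x≡u) x≢u _ = contradiction x≡u x≢u
  internal-neighbours (_ ◅ _) _ (here x≡u) x≢u _ = contradiction x≡u x≢u
  internal-neighbours (_ ◅ ε) _ (there (here x≡v)) _ x≢v = contradiction x≡v x≢v
  internal-neighbours (e ◅ f ◅ w) ((_ ∷ u∉w) ∷ _) (there (here refl)) _ _ =
    _ , _ , All.lookup u∉w (source∈vertices w) , e , f
  internal-neighbours (_ ◅ w@(_ ◅ _)) (_ ∷ uniq@(y∉w ∷ _)) (there (there x∈w)) _ x≢v =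
    internal-neighbours w uniq (there x∈w) (≢-sym (All.lookup y∉w x∈w)) x≢v

-- Bistars and their Steiner trees

-- Both stars (hub constant) and double stars: the root is hub 0ℙ, and a vertex v
-- is attached to the hub selected by side v, a root to itself.
record Bistar (S : Subset n) : Set where
  field
    hub  : Parity → Fin n
    side : Fin n → Parity

  root : Fin n
  root = hub 0ℙ

  parent : Fin n → Fin n
  parent v = hub (side v)

  span : Subset n
  span = S ∪ ⁅ root ⁆

  field
    parent-hub  : ∀ β → parent (hub β) ≡ root
    hub∈span    : ∀ β → hub β ∈ span
    root∉S⇒star : root ∉ S → ∀ v → parent v ≡ root

pigeonhole : {A : Set} (f : Parity → A) (a b c : Parity) →
             f a ≡ f b ⊎ f b ≡ f c ⊎ f a ≡ f c
pigeonhole f 0ℙ 0ℙ _  = inj₁ refl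
pigeonhole f 1ℙ 1ℙ _  = inj₁ refl
pigeonhole f 0ℙ 1ℙ 1ℙ = inj₂ (inj₁ refl)
pigeonhole f 1ℙ 0ℙ 0ℙ = inj₂ (inj₁ refl)
pigeonhole f 0ℙ 1ℙ 0ℙ = inj₂ (inj₂ refl)
pigeonhole f 1ℙ 0ℙ 1ℙ = inj₂ (inj₂ refl)

∈-tabulate-does : {P : Fin n → Set} (P? : ∀ v → Dec (P v)) {v : Fin n} →
                  P v → v ∈ tabulate (does ∘ P?)
∈-tabulate-does P? {v} Pv =
  lookup⇒[]= v _ (trans (lookup∘tabulate (does ∘ P?) v) (dec-true (P? v) Pv))

module BistarTree {S : Subset n} (B : Bistar S) where
  open Bistar B

  Edge : Fin n → Fin n → Set
  Edge u v = u ≢ v × (u ∈ span × v ∈ span) × (parent u ≡ v ⊎ parent v ≡ u)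

  subgraph : Subgraph (K n)
  subgraph = record
    { V     = span
    ; E     = Edge
    ; E?    = λ u v → ¬? (u Fin.≟ v)
                      ×-dec (u Subset.∈? span ×-dec v Subset.∈? span)
                      ×-dec (parent u Fin.≟ v ⊎-dec parent v Fin.≟ u)
    ; E-sym = λ (u≢v , (u∈V , v∈V) , p) → ≢-sym u≢v , (v∈V , u∈V) , swap p
    ; E⊆G   = proj₁
    ; E⊆V   = proj₁ ∘ proj₂
    }
  open Subgraph subgraph using (E-sym; E?)

  Hub : Fin n → Set
  Hub x = ∃[ β ] hub β ≡ x

  ∈span⁻ : ∀ {v} → v ∈ span → v ∈ S ⊎ v ≡ root
  ∈span⁻ v∈V with Subset.x∈p∪q⁻ S ⁅ root ⁆ v∈V
  ... | inj₁ v∈S    = inj₁ v∈S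
  ... | inj₂ v∈root = inj₂ (Subset.x∈⁅y⁆⇒x≡y root v∈root)

  S⊆span : S ⊆ span
  S⊆span = Subset.p⊆p∪q ⁅ root ⁆

  -- At most one of two distinct neighbours is the parent of `x`, so the other has `x` as its
  -- parent.
  two-neighbours⇒hub : ∀ {x y z} → y ≢ z → Edge y x → Edge x z → Hub x
  two-neighbours⇒hub y≢z (_ , _ , inj₁ py≡x) _ = _ , py≡x
  two-neighbours⇒hub y≢z _ (_ , _ , inj₂ pz≡x) = _ , pz≡x
  two-neighbours⇒hub y≢z (_ , _ , inj₂ px≡y) (_ , _ , inj₁ px≡z) =
    contradiction (trans (sym px≡y) px≡z) y≢z

  internal⇒hub : ∀ {u v x} (p : Path subgraph u v) → Internal p x → Hub x
  internal⇒hub p (x∈p , x≢u , x≢v) =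
    let _ , _ , y≢z , e , f =
          internal-neighbours subgraph (Path.walk p) (Path.simple p) x∈p x≢u x≢v
    in two-neighbours⇒hub y≢z e f

  ¬three-hubs : ∀ {x y z} → Hub x → Hub y → Hub z →
                x ≢ y → y ≢ z → x ≢ z → ∀ {A : Set} → A
  ¬three-hubs (a , refl) (b , refl) (c , refl) x≢y y≢z x≢z with pigeonhole hub a b c
  ... | inj₁ x≡y        = contradiction x≡y x≢y
  ... | inj₂ (inj₁ y≡z) = contradiction y≡z y≢z
  ... | inj₂ (inj₂ x≡z) = contradiction x≡z x≢z

  -- Every vertex of a cycle has two distinct neighbours, so it is a hub.
  acyclic : Acyclic subgraph
  acyclic record { walk = ε } (s≤s ())
  acyclic record { walk = _ ◅ ε } (s≤s (s≤s ()))
  -- The first three vertices of the cycle would be three distinct hubs. In a triangle the third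
  -- vertex is followed by `u` along `g`; on a longer cycle it is followed by the next vertex of the
  -- walk.
  acyclic record { walk = e ◅ f ◅ ε ; simple = (u≢x ∷ u≢v ∷ []) ∷ (x≢v ∷ []) ∷ _ } _ g =
    ¬three-hubs (two-neighbours⇒hub (≢-sym x≢v) g e)
                (two-neighbours⇒hub u≢v e f)
                (two-neighbours⇒hub (≢-sym u≢x) f g) u≢x x≢v u≢v
  acyclic record { walk   = e ◅ f ◅ f′ ◅ w
                 ; simple = (u≢x ∷ u≢y ∷ _) ∷ (x≢y ∷ x∉w) ∷ _ } _ g =
    ¬three-hubs (two-neighbours⇒hub (≢-sym (All.lookup x∉w (target∈vertices subgraph w))) g e)
                (two-neighbours⇒hub u≢y e f)
                (two-neighbours⇒hub (All.lookup x∉w (source∈vertices subgraph w)) f f′)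
                u≢x x≢y u≢y

  walk-to-parent : ∀ {u} → u ∈ span → Walk subgraph u (parent u)
  walk-to-parent {u} u∈V with u Fin.≟ parent u
  -- Only the root is its own parent, and `Edge` excludes loops.
  ... | yes u≡p = subst (Walk subgraph u) u≡p ε
  ... | no  u≢p = (u≢p , (u∈V , hub∈span _) , inj₁ refl) ◅ ε

  walk-to-root : ∀ {u} → u ∈ span → Walk subgraph u root
  walk-to-root {u} u∈V =
    walk-to-parent u∈V ◅◅
    subst (Walk subgraph (parent u)) (parent-hub (side u)) (walk-to-parent (hub∈span _))

  isTree : IsTree subgraph
  isTree = record
    { nonempty  = root , hub∈span 0ℙ
    ; connected = λ _ _ u∈V v∈V → eraseLoops subgraph
                    (walk-to-root u∈V ◅◅ reverse E-sym (walk-to-root v∈V))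
    ; acyclic   = acyclic
    }

  -- A root outside `S` is the centre of a star, hence adjacent to all of `S`. With `∣ S ∣ ≥ 2` this
  -- keeps it from being a leaf.
  root∉S⇒∣S∣≤degree : root ∉ S → ∣ S ∣ ≤ degree subgraph root
  root∉S⇒∣S∣≤degree root∉S = Subset.p⊆q⇒∣p∣≤∣q∣ λ {w} w∈S →
    ∈-tabulate-does (E? root)
      ( (λ root≡w → root∉S (subst (_∈ S) (sym root≡w) w∈S))
      , (hub∈span 0ℙ , S⊆span w∈S)
      , inj₂ (root∉S⇒star root∉S w))

  leaf∈S : ∣ S ∣ ≥ 2 → ∀ v → Leaf subgraph v → v ∈ S
  leaf∈S 2≤s v (v∈V , deg≡1) with v Subset.∈? S | ∈span⁻ v∈V
  ... | yes v∈S | _          = v∈S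
  ... | no  v∉S | inj₁ v∈S   = contradiction v∈S v∉S
  ... | no  v∉S | inj₂ refl  = contradiction
    (ℕ.≤-trans 2≤s (subst (∣ S ∣ ≤_) deg≡1 (root∉S⇒∣S∣≤degree v∉S))) λ { (s≤s ()) }

  steinerTree : ∣ S ∣ ≥ 2 → SteinerTree (K n) S
  steinerTree 2≤s = record
    { subgraph = subgraph
    ; isTree   = isTree
    ; S⊆V      = S⊆span
    ; leaves∈S = leaf∈S 2≤s
    }

open BistarTree using (steinerTree; ∈span⁻; S⊆span; internal⇒hub)

-- Compatibility of bistars and complete independence

record Compatible {S : Subset n} (A B : Bistar S) : Set where
  private
    module A = Bistar A
    module B = Bistar B
  field
    hubs-disjoint : ∀ β γ → A.hub β ≢ B.hub γ
    -- A common edge must join a hub of A to a hub of B, each being the parent of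
    -- the other.
    no-mutual     : ∀ v → v ∈ S → A.parent v ∈ S → B.parent (A.parent v) ≢ v

  span∩⊆S : ∀ {v} → v ∈ A.span → v ∈ B.span → v ∈ S
  span∩⊆S v∈A v∈B with ∈span⁻ A v∈A | ∈span⁻ B v∈B
  ... | inj₁ v∈S  | _         = v∈S
  ... | inj₂ _    | inj₁ v∈S  = v∈S
  ... | inj₂ v≡a  | inj₂ v≡b  = contradiction (trans (sym v≡a) v≡b) (hubs-disjoint 0ℙ 0ℙ)

  spans-meet : A.span ∩ B.span ≡ S
  spans-meet = Subset.⊆-antisym
    (λ v∈ → let v∈A , v∈B = Subset.x∈p∩q⁻ A.span B.span v∈ in span∩⊆S v∈A v∈B)
    (λ v∈S → Subset.x∈p∩q⁺ (S⊆span A v∈S , S⊆span B v∈S))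

  edges-disjoint : ∀ u v → BistarTree.Edge A u v → BistarTree.Edge B u v → ∀ {X : Set} → X
  edges-disjoint u v (_ , (u∈A , v∈A) , p) (_ , (u∈B , v∈B) , q) =
    case p q (span∩⊆S u∈A u∈B) (span∩⊆S v∈A v∈B)
    where
    case : A.parent u ≡ v ⊎ A.parent v ≡ u → B.parent u ≡ v ⊎ B.parent v ≡ u →
           u ∈ S → v ∈ S → ∀ {X : Set} → X
    -- Orient edges from child to parent: equal orientations give a common hub, opposite ones
    -- contradict `no-mutual`.
    case (inj₁ refl) (inj₁ q)    _   _   = contradiction (sym q) (hubs-disjoint _ _)
    case (inj₁ refl) (inj₂ q)    u∈S v∈S = contradiction q (no-mutual u u∈S v∈S)
    case (inj₂ refl) (inj₁ q)    u∈S v∈S = contradiction q (no-mutual v v∈S u∈S)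
    case (inj₂ refl) (inj₂ q)    _   _   = contradiction (sym q) (hubs-disjoint _ _)

Compatible-sym : {S : Subset n} {A B : Bistar S} → Compatible A B → Compatible B A
Compatible-sym {S = S} {A} {B} c = record
  { hubs-disjoint = λ β γ → ≢-sym (hubs-disjoint γ β)
  ; no-mutual     = λ v v∈S Bv∈S ABv≡v →
      -- A mutual pair seen from `v` is also one seen from its other end, the parent of `v` in `B`.
      no-mutual (Bistar.parent B v) Bv∈S (subst (_∈ S) (sym ABv≡v) v∈S)
                (cong (Bistar.parent B) ABv≡v)
  }
  where open Compatible c

completelyIndependent : {S : Subset n} (2≤s : ∣ S ∣ ≥ 2) (B : Fin k → Bistar S) →
  (∀ {p q} → p ≢ q → Compatible (B p) (B q)) →
  CompletelyIndependent (λ p → steinerTree (B p) 2≤s)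
completelyIndependent 2≤s B compatible = record
  { edge-disjoint  = λ p q p<q u v e f →
      Compatible.edges-disjoint (compatible (Fin.<⇒≢ p<q)) u v e f
  ; vertices-meet  = λ p q p<q → Compatible.spans-meet (compatible (Fin.<⇒≢ p<q))
  ; paths-disjoint = λ p q p<q _ _ _ _ _ P Q x x∈P x∈Q →
      let β , β≡x = internal⇒hub (B p) P x∈P
          γ , γ≡x = internal⇒hub (B q) Q x∈Q
      in Compatible.hubs-disjoint (compatible (Fin.<⇒≢ p<q)) β γ (trans β≡x (sym γ≡x))
  }

-- Enumerating a subset and pairing its elements

-- The number of elements of `S` below the given vertex. It is defined on all of `Fin n` because
-- `side` must be.
rank : Subset n → Fin n → ℕ
rank (_       ∷ S) zero    = 0
rank (inside  ∷ S) (suc v) = suc (rank S v)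
rank (outside ∷ S) (suc v) = rank S v

enumerate : (S : Subset n) → Fin ∣ S ∣ → Fin n
enumerate (outside ∷ S) i       = suc (enumerate S i)
enumerate (inside  ∷ S) zero    = zero
enumerate (inside  ∷ S) (suc i) = suc (enumerate S i)

rank-enumerate : (S : Subset n) (i : Fin ∣ S ∣) → rank S (enumerate S i) ≡ toℕ i
rank-enumerate (outside ∷ S) i       = rank-enumerate S i
rank-enumerate (inside  ∷ S) zero    = refl
rank-enumerate (inside  ∷ S) (suc i) = cong suc (rank-enumerate S i)

enumerate-injective : (S : Subset n) {i j : Fin ∣ S ∣} →
                      enumerate S i ≡ enumerate S j → i ≡ j
enumerate-injective S {i} {j} eq = Fin.toℕ-injective
  (trans (sym (rank-enumerate S i)) (trans (cong (rank S) eq) (rank-enumerate S j)))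

enumerate∈ : (S : Subset n) (i : Fin ∣ S ∣) → enumerate S i ∈ S
enumerate∈ (outside ∷ S) i       = there (enumerate∈ S i)
enumerate∈ (inside  ∷ S) zero    = here
enumerate∈ (inside  ∷ S) (suc i) = there (enumerate∈ S i)

-- This is `2j + β`, the inverse of splitting a number into its half and its parity.
fromHalf : ℕ → Parity → ℕ
fromHalf zero    0ℙ = 0
fromHalf zero    1ℙ = 1
fromHalf (suc j) β  = suc (suc (fromHalf j β))

⌊fromHalf/2⌋ : ∀ j β → ⌊ fromHalf j β /2⌋ ≡ j
⌊fromHalf/2⌋ zero    0ℙ = refl
⌊fromHalf/2⌋ zero    1ℙ = refl
⌊fromHalf/2⌋ (suc j) β  = cong suc (⌊fromHalf/2⌋ j β)

parity-fromHalf : ∀ j β → parity (fromHalf j β) ≡ β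
parity-fromHalf zero    0ℙ = refl
parity-fromHalf zero    1ℙ = refl
parity-fromHalf (suc j) β  = parity-fromHalf j β

-- From `j + 1 ≤ ⌊ s /2⌋` follows `2j + 2 ≤ s`, so both members of pair `j` exist.
fromHalf< : ∀ {j} s β → j < ⌊ s /2⌋ → fromHalf j β < s
fromHalf< {zero}  (suc (suc s)) 0ℙ _         = s≤s z≤n
fromHalf< {zero}  (suc (suc s)) 1ℙ _         = s≤s (s≤s z≤n)
fromHalf< {suc j} (suc (suc s)) β  (s≤s j<s) = s≤s (s≤s (fromHalf< s β j<s))

-- The hub of pair i to which vertex β of pair j is attached.
attach : ℕ → ℕ → Parity → Parity
attach zero    zero    _ = 0ℙ
attach zero    (suc _) β = β
attach (suc _) zero    β = β ⁻¹
attach (suc i) (suc j) β = attach i j β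

attach-≡ : ∀ i β → attach i i β ≡ 0ℙ
attach-≡ zero    _ = refl
attach-≡ (suc i) β = attach-≡ i β

attach-< : ∀ {i j} β → i < j → attach i j β ≡ β
attach-< {zero}  {suc _} _ _         = refl
attach-< {suc _} {suc _} β (s≤s i<j) = attach-< β i<j

attach-> : ∀ {i j} β → j < i → attach i j β ≡ β ⁻¹
attach-> {suc _} {zero}  _ _         = refl
attach-> {suc _} {suc _} β (s≤s j<i) = attach-> β j<i

-- The family of stars and double stars

module Family (S : Subset n) where

  star : ∀ c → c ∉ S → Bistar S
  star c c∉S = record
    { hub         = const c
    ; side        = const 0ℙ
    ; parent-hub  = λ _ → refl
    ; hub∈span    = λ _ → Subset.q⊆p∪q S ⁅ c ⁆ (Subset.x∈⁅x⁆ c)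
    ; root∉S⇒star = λ _ _ → refl
    }

  pairIndex : Fin n → ℕ
  pairIndex v = ⌊ rank S v /2⌋

  pairSide : Fin n → Parity
  pairSide v = parity (rank S v)

  pair : Fin ⌊ ∣ S ∣ /2⌋ → Parity → Fin n
  pair i β = enumerate S (fromℕ< (fromHalf< ∣ S ∣ β (Fin.toℕ<n i)))

  pair∈S : ∀ i β → pair i β ∈ S
  pair∈S i β = enumerate∈ S _

  rank-pair : ∀ i β → rank S (pair i β) ≡ fromHalf (toℕ i) β
  rank-pair i β = trans (rank-enumerate S _) (Fin.toℕ-fromℕ< _)

  pairIndex-pair : ∀ i β → pairIndex (pair i β) ≡ toℕ i
  pairIndex-pair i β = trans (cong ⌊_/2⌋ (rank-pair i β)) (⌊fromHalf/2⌋ (toℕ i) β)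

  pairSide-pair : ∀ i β → pairSide (pair i β) ≡ β
  pairSide-pair i β = trans (cong parity (rank-pair i β)) (parity-fromHalf (toℕ i) β)

  -- For odd `∣ S ∣` the vertex left over has rank `∣ S ∣ ∸ 1`, so its index exceeds every `i` and
  -- its side is `0ℙ`: it is attached to the root, like the first vertex of a later pair.
  doubleSide : Fin ⌊ ∣ S ∣ /2⌋ → Fin n → Parity
  doubleSide i v = attach (toℕ i) (pairIndex v) (pairSide v)

  doubleSide-pair : ∀ i j β → doubleSide i (pair j β) ≡ attach (toℕ i) (toℕ j) β
  doubleSide-pair i j β =
    cong₂ (attach (toℕ i)) (pairIndex-pair j β) (pairSide-pair j β)

  doubleStar : Fin ⌊ ∣ S ∣ /2⌋ → Bistar S
  doubleStar i = record
    { hub         = pair i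
    ; side        = doubleSide i
    ; parent-hub  = λ β →
        cong (pair i) (trans (doubleSide-pair i i β) (attach-≡ (toℕ i) β))
    ; hub∈span    = λ β → Subset.p⊆p∪q ⁅ pair i 0ℙ ⁆ (pair∈S i β)
    ; root∉S⇒star = λ a∉S → contradiction (pair∈S i 0ℙ) a∉S
    }

  star-star : ∀ {c d} (c∉S : c ∉ S) (d∉S : d ∉ S) → c ≢ d →
              Compatible (star c c∉S) (star d d∉S)
  star-star c∉S _ c≢d = record
    { hubs-disjoint = λ _ _ → c≢d
    ; no-mutual     = λ _ _ c∈S → contradiction c∈S c∉S
    }

  star-double : ∀ {c} (c∉S : c ∉ S) i → Compatible (star c c∉S) (doubleStar i)
  star-double c∉S i = record
    { hubs-disjoint = λ _ β c≡ → c∉S (subst (_∈ S) (sym c≡) (pair∈S i β))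
    ; no-mutual     = λ _ _ c∈S → contradiction c∈S c∉S
    }

  double-double-< : ∀ {i j} → toℕ i < toℕ j → Compatible (doubleStar i) (doubleStar j)
  double-double-< {i} {j} i<j = record
    { hubs-disjoint = λ β γ eq → ℕ.<⇒≢ i<j
        (trans (sym (pairIndex-pair i β)) (trans (cong pairIndex eq) (pairIndex-pair j γ)))
    -- Being a parent in the tree of pair `j`, `v` belongs to that pair.
    ; no-mutual     = λ v _ _ eq → no-mutual v _ (sym eq) eq
    }
    where
    -- Tree `i` attaches vertex `γ` of pair `j` to vertex `γ` of pair `i`, which tree `j` attaches
    -- to vertex `γ ⁻¹` of pair `j`. The round trip thus flips the side.
    no-mutual : ∀ v γ → v ≡ pair j γ → pair j (doubleSide j (pair i (doubleSide i v))) ≢ v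
    no-mutual v γ refl eq = p≢p⁻¹ γ (begin
      γ                                              ≡⟨ pairSide-pair j γ ⟨
      pairSide (pair j γ)                            ≡⟨ cong pairSide eq ⟨
      pairSide (pair j _)                            ≡⟨ pairSide-pair j _ ⟩
      doubleSide j (pair i (doubleSide i (pair j γ))) ≡⟨ doubleSide-pair j i _ ⟩
      attach (toℕ j) (toℕ i) (doubleSide i (pair j γ)) ≡⟨ attach-> _ i<j ⟩
      doubleSide i (pair j γ) ⁻¹                     ≡⟨ cong _⁻¹ (doubleSide-pair i j γ) ⟩
      attach (toℕ i) (toℕ j) γ ⁻¹                    ≡⟨ cong _⁻¹ (attach-< γ i<j) ⟩
      γ ⁻¹                                           ∎)
      where open ≡-Reasoning

  double-double : ∀ {i j} → i ≢ j → Compatible (doubleStar i) (doubleStar j)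
  double-double {i} {j} i≢j with Fin.<-cmp i j
  ... | tri< i<j _ _ = double-double-< i<j
  ... | tri≈ _ i≡j _ = contradiction i≡j i≢j
  ... | tri> _ _ j<i = Compatible-sym (double-double-< j<i)

  outer : Fin ∣ ∁ S ∣ → Fin n
  outer = enumerate (∁ S)

  outer∉S : ∀ i → outer i ∉ S
  outer∉S i = Subset.x∈∁p⇒x∉p (enumerate∈ (∁ S) i)

  bistar : Fin ∣ ∁ S ∣ ⊎ Fin ⌊ ∣ S ∣ /2⌋ → Bistar S
  bistar (inj₁ i) = star (outer i) (outer∉S i)
  bistar (inj₂ i) = doubleStar i

  compatible : ∀ x y → x ≢ y → Compatible (bistar x) (bistar y)
  compatible (inj₁ i) (inj₁ j) x≢y =
    star-star (outer∉S i) (outer∉S j) (x≢y ∘ cong inj₁ ∘ enumerate-injective (∁ S))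
  compatible (inj₁ i) (inj₂ j) _   = star-double (outer∉S i) j
  compatible (inj₂ i) (inj₁ j) _   = Compatible-sym (star-double (outer∉S j) i)
  compatible (inj₂ i) (inj₂ j) x≢y = double-double (x≢y ∘ cong inj₂)

  -- Counting and indexing the trees

  count : n ∸ ⌈ ∣ S ∣ /2⌉ ≡ ∣ ∁ S ∣ + ⌊ ∣ S ∣ /2⌋
  count = begin
    -- Since `s ≤ n`, the truncated difference `n ∸ s` is exact.
    n ∸ c                        ≡⟨ cong (_∸ c) (ℕ.m∸n+n≡m (Subset.∣p∣≤n S)) ⟨
    (n ∸ s) + s ∸ c              ≡⟨ cong (λ t → (n ∸ s) + t ∸ c) (ℕ.⌊n/2⌋+⌈n/2⌉≡n s) ⟨
    (n ∸ s) + (f + c) ∸ c        ≡⟨ cong (_∸ c) (ℕ.+-assoc (n ∸ s) f c) ⟨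
    (n ∸ s) + f + c ∸ c          ≡⟨ ℕ.m+n∸n≡m ((n ∸ s) + f) c ⟩
    (n ∸ s) + f                  ≡⟨ cong (_+ f) (Subset.∣∁p∣≡n∸∣p∣ S) ⟨
    ∣ ∁ S ∣ + f                  ∎
    where
    open ≡-Reasoning
    s = ∣ S ∣
    c = ⌈ s /2⌉
    f = ⌊ s /2⌋

  index : Fin (n ∸ ⌈ ∣ S ∣ /2⌉) → Fin ∣ ∁ S ∣ ⊎ Fin ⌊ ∣ S ∣ /2⌋
  index p = Fin.splitAt ∣ ∁ S ∣ (Fin.cast count p)

  index-injective : ∀ {p q} → index p ≡ index q → p ≡ q
  index-injective {p} {q} eq = Fin.toℕ-injective (begin
    toℕ p                 ≡⟨ Fin.toℕ-cast count p ⟨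
    toℕ (Fin.cast count p) ≡⟨ cong toℕ (Fin.join-splitAt ∣ ∁ S ∣ _ _) ⟨
    toℕ (Fin.join ∣ ∁ S ∣ _ (index p)) ≡⟨ cong (toℕ ∘ Fin.join ∣ ∁ S ∣ _) eq ⟩
    toℕ (Fin.join ∣ ∁ S ∣ _ (index q)) ≡⟨ cong toℕ (Fin.join-splitAt ∣ ∁ S ∣ _ _) ⟩
    toℕ (Fin.cast count q) ≡⟨ Fin.toℕ-cast count q ⟩
    toℕ q                 ∎)
    where open ≡-Reasoning

theorem2p6 : (n s : ℕ) (S : Subset n) → ∣ S ∣ ≡ s → s ≥ 2 →
    Σ[ T ∈ (Fin (n ∸ ⌈ s /2⌉) → SteinerTree (K n) S) ]
    CompletelyIndependent T
theorem2p6 n s S refl 2≤s =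
  (λ p → steinerTree (bistar (index p)) 2≤s) ,
  completelyIndependent 2≤s (bistar ∘ index)
    (λ p≢q → compatible _ _ (p≢q ∘ index-injective))
  where open Family S
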